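{- Let $(A,\ominus)$ be a $\ominus$-algebra with extended dual space $(X,i,+,\star)$. Assume further that $\neg$ is an involution, that the operation $a\oplus b:=\neg(\neg a\ominus b)$ is a right residual of $\ominus$ (that is, $a\leq b\oplus c\iff a\ominus c\leq b$ for all $a,b,c\in A$), and that $\oplus$ is commutative. The following are equivalent: 1. for all $a,b\in A$, $a\wedge b=a\ominus(a\ominus b)$; 2. for all $x,x',y\in X$, if $(x,y)\in\mathrm{dom}(\star)$, and there exists $w\in X$ with $w\nleq y$ such that $x'+w\leq x\star y$, then $x'\leq x$.
   Context: **$\ominus$-algebras.** A $\ominus$-algebra $(A,\ominus)$ is a bounded distributive lattice $A$ with a binary operation $\ominus$ such that for all $a,b,c\in A$: (1) $(a\wedge b)\ominus c=(a\ominus c)\wedge(b\ominus c)$, $(a\vee b)\ominus c=(a\ominus c)\vee(b\ominus c)$, $a\ominus(b\wedge c)=(a\ominus b)\vee(a\ominus c)$, $a\ominus(b\vee c)=(a\ominus b)\wedge(a\ominus c)$; (2) $0\ominus a=0$ and $a\ominus 1=0$; (3) $a\ominus 0=a$. Its negation is $\neg a:=1\ominus a$. **Canonical extension.** A complete lattice is doubly algebraic if it and its opposite are algebraic. The canonical extension $A^\delta$ of $A$ is the doubly algebraic distributive lattice (unique up to isomorphism fixing $A$) containing $A$ as a bounded sublattice such that every completely join-irreducible element of $A^\delta$ is a meet of elements of $A$, and such that $\bigwedge S\leq\bigvee T$ with $S,T\subseteq A$ implies $\bigwedge S'\leq\bigvee T'$ for some finite $S'\subseteq S$, $T'\subseteq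 T$. Here $u$ is completely join-irreducible (resp. completely meet-irreducible) if $u=\bigvee S$ (resp. $u=\bigwedge S$) implies $u\in S$; these elements form the posets $J^\infty(A^\delta)$, $M^\infty(A^\delta)$, and $\kappa\colon J^\infty(A^\delta)\to M^\infty(A^\delta)$, $\kappa(j)=\bigvee\{u\in A^\delta\mid j\nleq u\}$, is an order isomorphism. $F(A^\delta)$ (filter elements) and $I(A^\delta)$ (ideal elements) are the sets of arbitrary meets, resp. joins, of elements of $A$. For $u,v\in A^\delta$, $u\ominus^\sigma v=\bigvee\bigwedge\{a\ominus b\mid a\in[p_1,q_1]\cap A,\ b\in[p_2,q_2]\cap A\}$ and $u\ominus^\pi v=\bigwedge\bigvee\{a\ominus b\mid a\in[p_1,q_1]\cap A,\ b\in[p_2,q_2]\cap A\}$, where the outer join/meet ranges over all $p_1,p_2\in F(A^\delta)$, $q_1,q_2\in I(A^\delta)$ with $p_1\leq u\leq q_1$, $p_2\leq v\leq q_2$. The $\sigma$- and $\pi$-extensions of $\neg$ (defined analogously) coincide; their common value is $\neg^\delta$. **Dual space.** The dual space $X$ of $A$ is the Priestley space of $A$, e.g. the set of prime ideals of $A$ ordered by inclusion, writing $I_x$ for the prime ideal corresponding to $x\in X$ and $F_x=A\setminus I_x$; the topology is generated by the sets $\widehat a=\{x\in X\mid a\notin I_x\}$ ($a\in A$) and their complements, and $a\mapsto\widehat a$ is an isomorphism of $A$ onto the lattice of clopen down-sets of $X$. There are order isomorphisms $\mu\colon X\to M^\infty(A^\delta)$, $\mu(x)=\bigvee I_x$, and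 $\nu\colon X\to J^\infty(A^\delta)$, $\nu(x)=\bigwedge F_x$, with $\kappa(\nu(x))=\mu(x)$. **Extended dual space.** The map $i\colon X\to X$ is the continuous order-reversing map determined by $I_{i(x)}=\{a\in A\mid\neg a\in F_x\}$. For $y\in X$, $\ominus^{\sigma\sharp}$ is determined by $u\ominus^\sigma\mu(y)\leq v\iff u\leq v\ominus^{\sigma\sharp}\mu(y)$ ($u,v\in A^\delta$), and, for $u\leq\neg^\delta\nu(y)$, $\ominus^{\pi\flat}$ is determined by $u\leq v\ominus^\pi\nu(y)\iff u\ominus^{\pi\flat}\nu(y)\leq v$ ($v\in A^\delta$). Define partial operations on $X$: $\mathrm{dom}(+)=\{(x,y)\mid y\leq i(x)\}$, $x+y=\mu^{ -1}(\mu(x)\ominus^{\sigma\sharp}\mu(y))$; $\mathrm{dom}(\star)=\{(x,y)\mid i(x)\nleq y\}$, $x\star y=\nu^{ -1}(\nu(x)\ominus^{\pi\flat}\nu(y))$ (these are well defined). The extended dual space of $(A,\ominus)$ is $(X,i,+,\star)$. An inequality involving partial terms asserts in particular that the terms are defined; so "$x'+w\leq x\star y$" includes $(x',w)\in\mathrm{dom}(+)$. -}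

module Defs where

open import Algebra.Core using (Op₁; Op₂)
open import Algebra.Definitions using (Congruent₂; Commutative; Involutive)
open import Axiom.ExcludedMiddle using (ExcludedMiddle)
open import Data.List.Base using (List)
open import Data.List.Relation.Unary.All using (All)
open import Data.Product.Base using (_×_; _,_; ∃-syntax)
open import Data.Sum.Base using (_⊎_; inj₁; inj₂; [_,_]′)
open import Function.Bundles using (_⇔_)
open import Level using (Level; suc)
open import Relation.Binary.Core using (Rel)
open import Relation.Binary.Lattice.Bundles using (BoundedLattice)
open import Relation.Binary.Lattice.Structures
  using (IsBoundedLattice; IsDistributiveLattice)
import Relation.Binary.Lattice.Properties.JoinSemilattice as JoinProperties
import Relation.Binary.Lattice.Properties.Lattice as LatticeProperties
open import Relation.Nullary.Decidable.Core using (yes; no)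
import Relation.Nullary.Negation.Core as Neg
open import Relation.Unary using (Pred)
import Data.List.Membership.Setoid as Membership

record ⊖-Algebra (ℓ : Level) : Set (suc ℓ) where
  infix  4 _≈_ _≤_
  infixr 6 _∨_
  infixr 7 _∧_
  infix  8 _⊖_ _⊕_
  field
    Carrier               : Set ℓ
    _≈_                   : Rel Carrier ℓ
    _≤_                   : Rel Carrier ℓ
    _∨_                   : Op₂ Carrier
    _∧_                   : Op₂ Carrier
    ⊤                     : Carrier
    ⊥                     : Carrier
    isBoundedLattice      : IsBoundedLattice _≈_ _≤_ _∨_ _∧_ ⊤ ⊥
    isDistributiveLattice : IsDistributiveLattice _≈_ _≤_ _∨_ _∧_
    _⊖_                   : Op₂ Carrier
    ⊖-cong                : Congruent₂ _≈_ _⊖_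
    ∧-⊖                   : ∀ a b c → (a ∧ b) ⊖ c ≈ (a ⊖ c) ∧ (b ⊖ c)
    ∨-⊖                   : ∀ a b c → (a ∨ b) ⊖ c ≈ (a ⊖ c) ∨ (b ⊖ c)
    ⊖-∧                   : ∀ a b c → a ⊖ (b ∧ c) ≈ (a ⊖ b) ∨ (a ⊖ c)
    ⊖-∨                   : ∀ a b c → a ⊖ (b ∨ c) ≈ (a ⊖ b) ∧ (a ⊖ c)
    ⊥-⊖                   : ∀ a → ⊥ ⊖ a ≈ ⊥
    ⊖-⊤                   : ∀ a → a ⊖ ⊤ ≈ ⊥
    ⊖-⊥                   : ∀ a → a ⊖ ⊥ ≈ a

  boundedLattice : BoundedLattice ℓ ℓ ℓ
  boundedLattice = record { isBoundedLattice = isBoundedLattice }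

  open BoundedLattice boundedLattice public
    hiding (Carrier; _≈_; _≤_; _∨_; _∧_; ⊤; ⊥; isBoundedLattice)

  ¬_ : Op₁ Carrier
  ¬ a = ⊤ ⊖ a

  _⊕_ : Op₂ Carrier
  a ⊕ b = ¬ ((¬ a) ⊖ b)

  NegationInvolutive : Set ℓ
  NegationInvolutive = Involutive _≈_ ¬_

  ⊕-RightResidual : Set ℓ
  ⊕-RightResidual = ∀ a b c → (a ≤ b ⊕ c) ⇔ (a ⊖ c ≤ b)

  ⊕-Commutative : Set ℓ
  ⊕-Commutative = Commutative _≈_ _⊕_

  ¬-antitone : ∀ {a b} → a ≤ b → ¬ b ≤ ¬ a
  ¬-antitone {a} {b} a≤b =
    trans (reflexive (Eq.trans (⊖-cong Eq.refl (Eq.sym (x≤y⇒x∨y≈y a≤b)))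
                               (⊖-∨ ⊤ a b)))
          (x∧y≤x (¬ a) (¬ b))
    where open JoinProperties joinSemilattice using (x≤y⇒x∨y≈y)

-- Subsets are arbitrary predicates, not necessarily closed under _≈_;
-- "u ∈ S" is therefore always read as "u is ≈ to some member of S".

record CompleteLattice (ℓ : Level) : Set (suc ℓ) where
  field
    boundedLattice : BoundedLattice ℓ ℓ ℓ

  open BoundedLattice boundedLattice public

  field
    ⋁          : Pred Carrier ℓ → Carrier
    ⋁-upper    : ∀ S {x} → S x → x ≤ ⋁ S
    ⋁-least    : ∀ S {u} → (∀ {x} → S x → x ≤ u) → ⋁ S ≤ u
    ⋀          : Pred Carrier ℓ → Carrier
    ⋀-lower    : ∀ S {x} → S x → ⋀ S ≤ x
    ⋀-greatest : ∀ S {u} → (∀ {x} → S x → u ≤ x) → u ≤ ⋀ S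

  open Membership setoid public using (_∈_)

  IsCompact : Carrier → Set (suc ℓ)
  IsCompact k = ∀ S → k ≤ ⋁ S →
    ∃[ xs ] All S xs × k ≤ ⋁ (_∈ xs)

  IsAlgebraic : Set (suc ℓ)
  IsAlgebraic = ∀ u → ∃[ S ] (∀ {k} → S k → IsCompact k) × u ≈ ⋁ S

  IsCompletelyJoinIrreducible : Carrier → Set (suc ℓ)
  IsCompletelyJoinIrreducible u = ∀ S → u ≈ ⋁ S → ∃[ s ] S s × u ≈ s

_ᵒᵖ : ∀ {ℓ} → CompleteLattice ℓ → CompleteLattice ℓ
L ᵒᵖ = record
  { boundedLattice = record
    { isBoundedLattice = record
      { isLattice = LatticeProperties.∧-∨-isLattice lattice
      ; maximum   = minimum
      ; minimum   = maximum
      }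
    }
  ; ⋁          = ⋀
  ; ⋁-upper    = ⋀-lower
  ; ⋁-least    = ⋀-greatest
  ; ⋀          = ⋁
  ; ⋀-lower    = ⋁-upper
  ; ⋀-greatest = ⋁-least
  }
  where open CompleteLattice L

IsDoublyAlgebraic : ∀ {ℓ} → CompleteLattice ℓ → Set (suc ℓ)
IsDoublyAlgebraic L =
  CompleteLattice.IsAlgebraic L × CompleteLattice.IsAlgebraic (L ᵒᵖ)

-- The carrier lives one universe above A so that F(A^δ) and I(A^δ), which
-- quantify over subsets of A, are again subsets of A^δ.

record CanonicalExtension {ℓ} (A : ⊖-Algebra ℓ) : Set (suc (suc ℓ)) where
  private module A = ⊖-Algebra A

  field
    completeLattice : CompleteLattice (suc ℓ)

  open CompleteLattice completeLattice public

  field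
    isDoublyAlgebraic     : IsDoublyAlgebraic completeLattice
    isDistributiveLattice : IsDistributiveLattice _≈_ _≤_ _∨_ _∧_

    e             : A.Carrier → Carrier
    e-cong        : ∀ {a b} → a A.≈ b → e a ≈ e b
    e-injective   : ∀ {a b} → e a ≈ e b → a A.≈ b
    e-∨           : ∀ a b → e (a A.∨ b) ≈ e a ∨ e b
    e-∧           : ∀ a b → e (a A.∧ b) ≈ e a ∧ e b
    e-⊤           : e A.⊤ ≈ ⊤
    e-⊥           : e A.⊥ ≈ ⊥

  ⋁ᴬ : Pred A.Carrier ℓ → Carrier
  ⋁ᴬ S = ⋁ λ u → ∃[ a ] S a × u ≈ e a

  ⋀ᴬ : Pred A.Carrier ℓ → Carrier
  ⋀ᴬ S = ⋀ λ u → ∃[ a ] S a × u ≈ e a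

  IsFilterElement : Pred Carrier (suc ℓ)
  IsFilterElement p = ∃[ S ] p ≈ ⋀ᴬ S

  IsIdealElement : Pred Carrier (suc ℓ)
  IsIdealElement q = ∃[ S ] q ≈ ⋁ᴬ S

  private
    infix 4 _∈ᴬ_
    _∈ᴬ_ : A.Carrier → List A.Carrier → Set ℓ
    _∈ᴬ_ = Membership._∈_ A.setoid

  -- Density and compactness of A in A^δ; finite subsets are given by lists.

  field
    dense   : ∀ {u} → IsCompletelyJoinIrreducible u → IsFilterElement u
    compact : ∀ S T → ⋀ᴬ S ≤ ⋁ᴬ T →
              ∃[ xs ] ∃[ ys ] All S xs × All T ys ×
                              ⋀ᴬ (_∈ᴬ xs) ≤ ⋁ᴬ (_∈ᴬ ys)

  _∈[_,_] : A.Carrier → Carrier → Carrier → Set (suc ℓ)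
  a ∈[ p , q ] = p ≤ e a × e a ≤ q

  Bracket : Carrier → Carrier → Carrier → Set (suc ℓ)
  Bracket u p q = IsFilterElement p × IsIdealElement q × p ≤ u × u ≤ q

  differences : (p₁ q₁ p₂ q₂ : Carrier) → Pred Carrier (suc ℓ)
  differences p₁ q₁ p₂ q₂ r =
    ∃[ a ] ∃[ b ] a ∈[ p₁ , q₁ ] × b ∈[ p₂ , q₂ ] × r ≈ e (a A.⊖ b)

  infix 8 _⊖σ_ _⊖π_

  _⊖σ_ : Op₂ Carrier
  u ⊖σ v = ⋁ λ r → ∃[ p₁ ] ∃[ q₁ ] ∃[ p₂ ] ∃[ q₂ ]
    Bracket u p₁ q₁ × Bracket v p₂ q₂ × r ≈ ⋀ (differences p₁ q₁ p₂ q₂)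

  _⊖π_ : Op₂ Carrier
  u ⊖π v = ⋀ λ r → ∃[ p₁ ] ∃[ q₁ ] ∃[ p₂ ] ∃[ q₂ ]
    Bracket u p₁ q₁ × Bracket v p₂ q₂ × r ≈ ⋁ (differences p₁ q₁ p₂ q₂)

  -- The σ- and π-extensions of ¬ coincide; this is the σ-formula.

  ¬ᵟ_ : Op₁ Carrier
  ¬ᵟ u = ⋁ λ r → ∃[ p ] ∃[ q ]
    Bracket u p q × r ≈ ⋀ λ s → ∃[ a ] a ∈[ p , q ] × s ≈ e (A.¬ a)

record PrimeIdeal {ℓ} (A : ⊖-Algebra ℓ) : Set (suc ℓ) where
  open ⊖-Algebra A hiding (¬_)
  field
    I          : Pred Carrier ℓ
    I-downward : ∀ {a b} → a ≤ b → I b → I a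
    I-⊥        : I ⊥
    I-∨        : ∀ {a b} → I a → I b → I (a ∨ b)
    I-proper   : Neg.¬ I ⊤
    I-prime    : ∀ {a b} → I (a ∧ b) → I a ⊎ I b

  F : Pred Carrier ℓ
  F a = Neg.¬ I a

-- Excluded middle is needed only to see that i x is again prime.

module ExtendedDual {ℓ} (em : ExcludedMiddle ℓ) (A : ⊖-Algebra ℓ)
                    (Aᵟ : CanonicalExtension A) where

  private module A = ⊖-Algebra A
  open CanonicalExtension Aᵟ using (⋁ᴬ; ⋀ᴬ; _⊖σ_; _⊖π_; ¬ᵟ_)
    renaming (Carrier to C; _≤_ to _≤ᵟ_)
  open PrimeIdeal

  X : Set (suc ℓ)
  X = PrimeIdeal A

  infix 4 _≤ˣ_ _≰ˣ_

  _≤ˣ_ : Rel X ℓ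
  x ≤ˣ y = ∀ {a} → I x a → I y a

  _≰ˣ_ : Rel X ℓ
  x ≰ˣ y = Neg.¬ (x ≤ˣ y)

  μ : X → C
  μ x = ⋁ᴬ (I x)

  ν : X → C
  ν x = ⋀ᴬ (F x)

  i : X → X
  i x = record
    { I          = λ a → F x (A.¬ a)
    ; I-downward = λ a≤b ¬b∈F ¬a∈I → ¬b∈F (I-downward x (A.¬-antitone a≤b) ¬a∈I)
    ; I-⊥        = λ ¬⊥∈I → I-proper x
                     (I-downward x (A.reflexive (A.Eq.sym (A.⊖-⊥ A.⊤))) ¬⊥∈I)
    ; I-∨        = λ {a} {b} ¬a∈F ¬b∈F ¬a∨b∈I →
                     [ ¬a∈F , ¬b∈F ]′ (I-prime x
                       (I-downward x (A.reflexive (A.Eq.sym (A.⊖-∨ A.⊤ a b))) ¬a∨b∈I))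
    ; I-proper   = λ ¬⊤∈F → ¬⊤∈F
                     (I-downward x (A.reflexive (A.⊖-⊤ A.⊤)) (I-⊥ x))
    ; I-prime    = prime
    }
    where
    prime : ∀ {a b} → F x (A.¬ (a A.∧ b)) → F x (A.¬ a) ⊎ F x (A.¬ b)
    prime {a} {b} ¬a∧b∈F with em {I x (A.¬ a)}
    ... | no  ¬a∈F = inj₁ ¬a∈F
    ... | yes ¬a∈I = inj₂ λ ¬b∈I →
      ¬a∧b∈F (I-downward x (A.reflexive (A.⊖-∧ A.⊤ a b)) (I-∨ x ¬a∈I ¬b∈I))

  -- The partially defined operations are given by their graphs:
  -- IsResidualσ v y r says that r is v ⊖^σ♯ μ(y), and
  -- IsResidualπ u y r says that u ≤ ¬^δ ν(y) and r is u ⊖^π♭ ν(y).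

  IsResidualσ : C → X → C → Set (suc ℓ)
  IsResidualσ v y r = ∀ u → (u ⊖σ μ y ≤ᵟ v) ⇔ (u ≤ᵟ r)

  IsResidualπ : C → X → C → Set (suc ℓ)
  IsResidualπ u y r =
    u ≤ᵟ (¬ᵟ ν y) × (∀ v → (u ≤ᵟ v ⊖π ν y) ⇔ (r ≤ᵟ v))

  dom+ : Rel X ℓ
  dom+ x y = y ≤ˣ i x

  dom⋆ : Rel X ℓ
  dom⋆ x y = i x ≰ˣ y

  infix 4 _+_↦_ _⋆_↦_ _+_≤_⋆_

  _+_↦_ : X → X → X → Set (suc ℓ)
  x + y ↦ z = dom+ x y × IsResidualσ (μ x) y (μ z)

  _⋆_↦_ : X → X → X → Set (suc ℓ)
  x ⋆ y ↦ z = dom⋆ x y × IsResidualπ (ν x) y (ν z)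

  _+_≤_⋆_ : X → X → X → X → Set (suc ℓ)
  x′ + w ≤ x ⋆ y = ∃[ s ] ∃[ t ] (x′ + w ↦ s) × (x ⋆ y ↦ t) × s ≤ˣ t

{-# OPTIONS --safe #-}
module Submission where

-- Density yields the dichotomy ν z ≤ u or u ≤ μ z for every u of A^δ, so that the
-- partial operations can be read off inside A: I(x + y) consists of the a with
-- a ⊖ b ∈ I x for some b ∈ I y, and F(x ⋆ y) of the a with a ⊖ b ∈ F x for some
-- b ∈ F y.  Since (a ⊕ b) ⊖ b ≈ ¬ b ⊖ (¬ b ⊖ a), condition 1 says that
-- a ∧ ¬ b ≤ (a ⊕ b) ⊖ b.  If a ∈ I x′ ∩ F x and b ∈ I w ∩ F y with ¬ b ∈ F x, the
-- element a ⊕ b lies in I(x′ + w), but by condition 1 also in F(x ⋆ y).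
-- Conversely, a prime x separating a ∧ ¬ b from (a ⊕ b) ⊖ b determines y, w and x′
-- explicitly, by residuation, so that condition 2 fails.
--
-- A^δ has enough completely join-irreducibles because it is dually algebraic; this
-- needs Zorn's lemma, which is available since excluded middle for arbitrary
-- types is a global choice operator.

open import Defs
open import Axiom.ExcludedMiddle using (ExcludedMiddle)
open import Axiom.Extensionality.Propositional using (Extensionality)
open import Data.Bool.Base using (Bool; T)
open import Data.Empty using (⊥-elim)
open import Data.List.Base using ([]; _∷_)
open import Data.List.Relation.Unary.All as All using (All; []; _∷_)
open import Data.List.Relation.Unary.Any using (Any; here; there)
open import Data.Product.Base using (_×_; _,_; ∃; ∃-syntax; proj₂)
open import Data.Sum.Base using (_⊎_; inj₁; inj₂; [_,_]′)
open import Function.Base using (id; _∘_)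
open import Function.Bundles using (_⇔_; mk⇔; Equivalence)
open import Level using (Lift; lift; suc)
open import Relation.Binary.PropositionalEquality using (_≡_; refl)
open import Relation.Binary.Core using (Rel)
open import Relation.Nullary.Decidable.Core
  using (Dec; yes; no; isYes; True; toWitness; fromWitness; decidable-stable)
open import Relation.Nullary.Negation.Core using (¬_; contradiction)
open import Relation.Binary.Lattice.Structures using (IsDistributiveLattice)
open import Relation.Unary using (Pred)
import Relation.Binary.Lattice.Properties.JoinSemilattice as JoinProperties
import Relation.Binary.Lattice.Properties.MeetSemilattice as MeetProperties

-- Excluded middle: decisions and change of universe.

isYes-⇔ : ∀ {p q} {P : Set p} {Q : Set q} (P? : Dec P) (Q? : Dec Q) →
          (P → Q) → (Q → P) → isYes P? ≡ isYes Q?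
isYes-⇔ (yes _) (yes _) _ _ = refl
isYes-⇔ (yes p) (no ¬q) f _ = contradiction (f p) ¬q
isYes-⇔ (no ¬p) (yes q) _ g = contradiction (g q) ¬p
isYes-⇔ (no _)  (no _)  _ _ = refl

module _ (em : ∀ {p} → ExcludedMiddle p) where

  by-contradiction : ∀ {p} {P : Set p} → ¬ ¬ P → P
  by-contradiction = decidable-stable em

  ¬∀⇒∃¬ : ∀ {a p q} {A : Set a} {P : Pred A p} {Q : Pred A q} →
          ¬ (∀ x → P x → Q x) → ∃[ x ] P x × ¬ Q x
  ¬∀⇒∃¬ ¬∀ = by-contradiction λ ¬∃ → ¬∀ λ x px →
    by-contradiction λ ¬qx → ¬∃ (x , px , ¬qx)

  -- `True` of a decision is small whatever the universe of `P`, so predicates living too high still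
  -- define subsets and ideals.
  Resize : ∀ {p} ℓ → Set p → Set ℓ
  Resize ℓ P = Lift ℓ (True (em {P = P}))

  resize : ∀ {p ℓ} {P : Set p} → P → Resize ℓ P
  resize p = lift (fromWitness p)

  unresize : ∀ {p ℓ} {P : Set p} → Resize ℓ P → P
  unresize (lift t) = toWitness t

-- Maximal elements avoiding a compact element, and meet-irreducibles.

module _ (em : ∀ {p} → ExcludedMiddle p)
         (funext : ∀ {a b} → Extensionality a b)
         {ℓ} (L : CompleteLattice ℓ) where

  open CompleteLattice L
    using (Carrier; _≈_; _≤_; ⋁; ⋁-upper; ⋁-least; ⋀; ⋀-lower; ⋀-greatest;
           module Eq; trans; reflexive; antisym; _∈_; IsCompact; IsAlgebraic)
    renaming (refl to ≤-refl)

  module MaximalAvoiding {k v} (k-compact : IsCompact k) (k≰v : ¬ k ≤ v) where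

    Improves : Rel Carrier ℓ
    Improves x y = (x ≤ y × ¬ y ≤ x) × ¬ k ≤ y

    improves? : Carrier → Carrier → Bool
    improves? x y = isYes (em {P = Improves x y})

    pick : (Carrier → Bool) → Carrier → Carrier
    pick P d with em {P = ∃ (T ∘ P)}
    ... | yes (y , _) = y
    ... | no  _       = d

    pick-spec : ∀ P d → T (P (pick P d)) ⊎ (pick P d ≡ d × ¬ ∃ (T ∘ P))
    pick-spec P d with em {P = ∃ (T ∘ P)}
    ... | yes (_ , p) = inj₁ p
    ... | no  ¬p      = inj₂ (refl , ¬p)

    pick-mono : ∀ {P Q d d′} → P ≡ Q → d ≤ d′ → pick P d ≤ pick Q d′
    pick-mono {P} refl d≤d′ with em {P = ∃ (T ∘ P)}
    ... | yes _ = ≤-refl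
    ... | no  _ = d≤d′

    -- Choosing from the Boolean predicate, not from the type of improvements,
    -- makes the choice depend on x only up to _≈_.
    next : Carrier → Carrier
    next x = pick (improves? x) x

    next-spec : ∀ x → Improves x (next x) ⊎ (next x ≡ x × ¬ ∃ (Improves x))
    next-spec x with pick-spec (improves? x) x
    ... | inj₁ t        = inj₁ (toWitness t)
    ... | inj₂ (eq , ¬p) = inj₂ (eq , λ (y , imp) → ¬p (y , fromWitness imp))

    -- Order-equivalent elements have the same improvements, and `funext` turns this into equality
    -- of the predicates given to `pick`.
    next-resp : ∀ {x y} → x ≤ y → y ≤ x → next x ≤ next y
    next-resp x≤y y≤x = pick-mono
      (funext λ z → isYes-⇔ em em (transfer y≤x x≤y) (transfer x≤y y≤x)) x≤y
      where
      transfer : ∀ {x y z} → y ≤ x → x ≤ y → Improves x z → Improves y z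
      transfer y≤x x≤y ((x≤z , z≰x) , k≰z) =
        (trans y≤x x≤z , λ z≤y → z≰x (trans z≤y y≤x)) , k≰z

    next-extensive : ∀ x → x ≤ next x
    next-extensive x with next-spec x
    ... | inj₁ ((x≤nx , _) , _) = x≤nx
    ... | inj₂ (eq , _) rewrite eq = ≤-refl

    next-avoids : ∀ {x} → ¬ k ≤ x → ¬ k ≤ next x
    next-avoids {x} k≰x with next-spec x
    ... | inj₁ (_ , k≰nx) = k≰nx
    ... | inj₂ (eq , _) rewrite eq = k≰x

    next-fixed : ∀ {x y} → next x ≤ x → x ≤ y → ¬ k ≤ y → y ≤ x
    next-fixed {x} {y} nx≤x x≤y k≰y with next-spec x
    ... | inj₁ ((_ , nx≰x) , _) = contradiction nx≤x nx≰x
    ... | inj₂ (_ , ¬imp) = by-contradiction em λ y≰x → ¬imp (y , (x≤y , y≰x) , k≰y)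

    -- Bourbaki–Witt: the closure of v under next and suprema is a chain, and its
    -- supremum is a fixed point of next.
    data Tower : Pred Carrier (suc ℓ) where
      base : Tower v
      step : ∀ {x} → Tower x → Tower (next x)
      sup  : ∀ P → P v → (∀ {x} → P x → Tower x) → Tower (⋁ P)

    base-least : ∀ {x} → Tower x → v ≤ x
    base-least base         = ≤-refl
    base-least (step t)     = trans (base-least t) (next-extensive _)
    base-least (sup P pv _) = ⋁-upper P pv

    -- No step of the tower jumps over such a `c`; `x ≤ c` with `¬ c ≤ x` expresses strictness
    -- modulo `≈`.
    Extreme : Pred Carrier (suc ℓ)
    Extreme c = ∀ {x} → Tower x → x ≤ c → ¬ c ≤ x → next x ≤ c

    -- Induction on `x`: a step from strictly below `c` stays below by extremality, and a step from
    -- an element equivalent to `c` lands on `next c`.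
    extreme-comparable : ∀ {c x} → Tower c → Extreme c → Tower x →
                         x ≤ c ⊎ next c ≤ x
    extreme-comparable tc ext base = inj₁ (base-least tc)
    extreme-comparable {c} tc ext (step {x} t) with extreme-comparable tc ext t
    ... | inj₂ nc≤x = inj₂ (trans nc≤x (next-extensive x))
    ... | inj₁ x≤c with em {P = c ≤ x}
    ...   | yes c≤x = inj₂ (next-resp c≤x x≤c)
    ...   | no  c≰x = inj₁ (ext t x≤c c≰x)
    extreme-comparable {c} tc ext (sup P pv P⊆T) with em {P = ∃[ x ] P x × next c ≤ x}
    ... | yes (x , px , nc≤x) = inj₂ (trans nc≤x (⋁-upper P px))
    ... | no  ¬∃ = inj₁ (⋁-least P λ px →
      [ id , (λ nc≤x → contradiction (_ , px , nc≤x) ¬∃) ]′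
        (extreme-comparable tc ext (P⊆T px)))

    -- Induction on `c`. At a supremum, some member `p` is not below `x`; comparability puts `x`
    -- strictly below `p`, and `p` is extreme.
    extreme : ∀ {c} → Tower c → Extreme c
    extreme base t x≤v v≰x = contradiction (base-least t) v≰x
    extreme (step {c} tc) {x} t x≤nc nc≰x
      with extreme-comparable tc (extreme tc) t
    ... | inj₂ nc≤x = contradiction nc≤x nc≰x
    ... | inj₁ x≤c with em {P = c ≤ x}
    ...   | yes c≤x = next-resp x≤c c≤x
    ...   | no  c≰x = trans (extreme tc t x≤c c≰x) (next-extensive c)
    extreme (sup P _ P⊆T) {x} t _ ⋁P≰x with
      ¬∀⇒∃¬ em {P = P} {Q = _≤ x} (λ P≤x → ⋁P≰x (⋁-least P (P≤x _)))
    ... | p , pp , p≰x with extreme-comparable (P⊆T pp) (extreme (P⊆T pp)) t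
    ...   | inj₂ np≤x = contradiction (trans (next-extensive p) np≤x) p≰x
    ...   | inj₁ x≤p  = trans (extreme (P⊆T pp) t x≤p p≰x) (⋁-upper P pp)

    tower-chain : ∀ {x y} → Tower x → Tower y → x ≤ y ⊎ y ≤ x
    tower-chain {x} {y} tx ty with extreme-comparable ty (extreme ty) tx
    ... | inj₁ x≤y  = inj₁ x≤y
    ... | inj₂ ny≤x = inj₂ (trans (next-extensive y) ny≤x)

    list-bound : ∀ {xs} → All (λ x → Tower x × ¬ k ≤ x) xs →
                 ∃[ m ] (Tower m × ¬ k ≤ m) × (∀ {x} → x ∈ xs → x ≤ m)
    list-bound [] = v , (base , k≰v) , λ ()
    list-bound {x ∷ _} ((tx , k≰x) ∷ all) with list-bound all
    ... | m , (tm , k≰m) , xs≤m with tower-chain tx tm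
    ...   | inj₁ x≤m = m , (tm , k≰m) , λ where
      (here z≈x)   → trans (reflexive z≈x) x≤m
      (there z∈xs) → xs≤m z∈xs
    ...   | inj₂ m≤x = x , (tx , k≰x) , λ where
      (here z≈x)   → reflexive z≈x
      (there z∈xs) → trans (xs≤m z∈xs) m≤x

    -- At a supremum, compactness would put `k` below a finite join of tower elements; these form a
    -- chain, so `k` would lie below a single one that avoids it.
    tower-avoids : ∀ {x} → Tower x → ¬ k ≤ x
    tower-avoids base     = k≰v
    tower-avoids (step t) = next-avoids (tower-avoids t)
    tower-avoids (sup P _ P⊆T) k≤⋁P with k-compact P k≤⋁P
    ... | xs , xs⊆P , k≤⋁xs
      with list-bound (All.map (λ px → P⊆T px , tower-avoids (P⊆T px)) xs⊆P)
    ...   | m , (_ , k≰m) , xs≤m = k≰m (trans k≤⋁xs (⋁-least (_∈ xs) xs≤m))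

    maximal : ∃[ m ] v ≤ m × ¬ k ≤ m × (∀ {y} → m ≤ y → ¬ k ≤ y → y ≤ m)
    maximal = ⋁ P , base-least t , tower-avoids t ,
      -- The supremum is in the tower, hence so is its successor, which is thus below it.
      next-fixed (⋁-upper P (resize em (step t)))
      where
      P : Pred Carrier ℓ
      P x = Resize em ℓ (Tower x)
      t : Tower (⋁ P)
      t = sup P (resize em base) (unresize em)

  separating-meet-irreducible :
    IsAlgebraic → ∀ {u v} → ¬ u ≤ v →
    ∃[ m ] v ≤ m × ¬ u ≤ m × CompleteLattice.IsCompletelyJoinIrreducible (L ᵒᵖ) m
  separating-meet-irreducible algebraic {u} {v} u≰v with algebraic u
  ... | K , K-compact , u≈⋁K with
    ¬∀⇒∃¬ em {P = K} {Q = _≤ v}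
      (λ K≤v → u≰v (trans (reflexive u≈⋁K) (⋁-least K (K≤v _))))
  ... | k , kK , k≰v with MaximalAvoiding.maximal (K-compact kK) k≰v
  ... | m , v≤m , k≰m , m-max =
    m , v≤m ,
    (λ u≤m → k≰m (trans (⋁-upper K kK) (trans (reflexive (Eq.sym u≈⋁K)) u≤m))) ,
    -- If no member of `S` is equivalent to `m`, all lie strictly above `m`, so maximality puts `k`
    -- below each of them and hence below `m`.
    λ S m≈⋀S → by-contradiction em λ ¬∃ → k≰m (trans
      (⋀-greatest S λ {s} Ss → by-contradiction em λ k≰s →
        let m≤s = trans (reflexive m≈⋀S) (⋀-lower S Ss)
        in ¬∃ (s , Ss , antisym m≤s (m-max m≤s k≰s)))
      (reflexive (Eq.sym m≈⋀S)))

module _ (em : ∀ {p} → ExcludedMiddle p)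
         (funext : ∀ {a b} → Extensionality a b)
         {ℓ} (A : ⊖-Algebra ℓ) (Aᵟ : CanonicalExtension A) where

  private module A where
    open ⊖-Algebra A public
    open JoinProperties joinSemilattice public using (∨-cong; x≤y⇒x∨y≈y)
    open MeetProperties meetSemilattice public using (∧-cong)

  open A using (_⊖_)
  open CanonicalExtension Aᵟ
    hiding (isDistributiveLattice)
    renaming (refl to ≤-refl)
  open PrimeIdeal
  open ExtendedDual em A Aᵟ

  -- Monotonicity of `⊖`, prime filters and the embedding `e`.

  ⊖-monoˡ : ∀ {a b} c → a A.≤ b → a ⊖ c A.≤ b ⊖ c
  ⊖-monoˡ {a} {b} c a≤b = A.trans (A.x≤x∨y (a ⊖ c) (b ⊖ c)) (A.reflexive
    (A.Eq.trans (A.Eq.sym (A.∨-⊖ a b c)) (A.⊖-cong (A.x≤y⇒x∨y≈y a≤b) A.Eq.refl)))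

  ⊖-antiʳ : ∀ {a b} c → a A.≤ b → c ⊖ b A.≤ c ⊖ a
  ⊖-antiʳ {a} {b} c a≤b = A.trans (A.reflexive
    (A.Eq.trans (A.⊖-cong A.Eq.refl (A.Eq.sym (A.x≤y⇒x∨y≈y a≤b))) (A.⊖-∨ c a b)))
    (A.x∧y≤x (c ⊖ a) (c ⊖ b))

  ⊖-mono : ∀ {a b c d} → a A.≤ b → d A.≤ c → a ⊖ c A.≤ b ⊖ d
  ⊖-mono a≤b d≤c = A.trans (⊖-monoˡ _ a≤b) (⊖-antiʳ _ d≤c)

  F-upward : ∀ (x : X) {a b} → a A.≤ b → F x a → F x b
  F-upward x a≤b a∉I b∈I = a∉I (I-downward x a≤b b∈I)

  F-⊤ : ∀ (x : X) → F x A.⊤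
  F-⊤ x = I-proper x

  F-∧ : ∀ (x : X) {a b} → F x a → F x b → F x (a A.∧ b)
  F-∧ x a∉I b∉I a∧b∈I = [ a∉I , b∉I ]′ (I-prime x a∧b∈I)

  e-mono : ∀ {a b} → a A.≤ b → e a ≤ e b
  e-mono {a} {b} a≤b = trans (x≤x∨y (e a) (e b))
    (reflexive (Eq.trans (Eq.sym (e-∨ a b)) (e-cong (A.x≤y⇒x∨y≈y a≤b))))

  e-cancel : ∀ {a b} → e a ≤ e b → a A.≤ b
  e-cancel {a} {b} ea≤eb = A.trans
    (A.reflexive (A.Eq.sym (e-injective (Eq.trans (e-∧ a b)
      (antisym (x∧y≤x (e a) (e b)) (∧-greatest ≤-refl ea≤eb))))))
    (A.x∧y≤y a b)

  ⋀ᴬ-lower : ∀ {S a} → S a → ⋀ᴬ S ≤ e a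
  ⋀ᴬ-lower Sa = ⋀-lower _ (_ , Sa , Eq.refl)

  ⋀ᴬ-greatest : ∀ {S u} → (∀ {a} → S a → u ≤ e a) → u ≤ ⋀ᴬ S
  ⋀ᴬ-greatest u≤S = ⋀-greatest _ λ (_ , Sa , w≈ea) →
    trans (u≤S Sa) (reflexive (Eq.sym w≈ea))

  ⋁ᴬ-upper : ∀ {S a} → S a → e a ≤ ⋁ᴬ S
  ⋁ᴬ-upper Sa = ⋁-upper _ (_ , Sa , Eq.refl)

  ⋁ᴬ-least : ∀ {S u} → (∀ {a} → S a → e a ≤ u) → ⋁ᴬ S ≤ u
  ⋁ᴬ-least S≤u = ⋁-least _ λ (_ , Sa , w≈ea) → trans (reflexive w≈ea) (S≤u Sa)

  e-filter : ∀ a → IsFilterElement (e a)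
  e-filter a = (a A.≈_) , antisym
    (⋀ᴬ-greatest λ a≈b → reflexive (e-cong a≈b)) (⋀ᴬ-lower A.Eq.refl)

  e-ideal : ∀ a → IsIdealElement (e a)
  e-ideal a = (a A.≈_) , antisym
    (⋁ᴬ-upper A.Eq.refl) (⋁ᴬ-least λ a≈b → reflexive (e-cong (A.Eq.sym a≈b)))

  ν-filter : ∀ x → IsFilterElement (ν x)
  ν-filter x = F x , Eq.refl

  μ-ideal : ∀ x → IsIdealElement (μ x)
  μ-ideal x = I x , Eq.refl

  ≤e⊤ : ∀ u → u ≤ e A.⊤
  ≤e⊤ u = trans (maximum u) (reflexive (Eq.sym e-⊤))

  e⊥≤ : ∀ u → e A.⊥ ≤ u
  e⊥≤ u = trans (reflexive e-⊥) (minimum u)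

  -- Compactness for filtered and directed subsets.

  Filtered Directed : ∀ {p} → Pred A.Carrier p → Set _
  Filtered P = ∃ P × (∀ {a b} → P a → P b → ∃[ c ] P c × c A.≤ a × c A.≤ b)
  Directed P = ∃ P × (∀ {a b} → P a → P b → ∃[ c ] P c × a A.≤ c × b A.≤ c)

  list-lower-bound : ∀ {p} {P : Pred A.Carrier p} {xs} → Filtered P → All P xs →
                     ∃[ c ] P c × All (c A.≤_) xs
  list-lower-bound ((c , Pc) , _) [] = c , Pc , []
  list-lower-bound filt@(_ , meet) (Px ∷ Pxs) =
    let d , Pd , d≤xs = list-lower-bound filt Pxs
        c , Pc , c≤x , c≤d = meet Px Pd
    in c , Pc , c≤x ∷ All.map (A.trans c≤d) d≤xs

  list-upper-bound : ∀ {p} {P : Pred A.Carrier p} {xs} → Directed P → All P xs →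
                     ∃[ c ] P c × All (A._≤ c) xs
  list-upper-bound ((c , Pc) , _) [] = c , Pc , []
  list-upper-bound dir@(_ , join) (Px ∷ Pxs) =
    let d , Pd , xs≤d = list-upper-bound dir Pxs
        c , Pc , x≤c , d≤c = join Px Pd
    in c , Pc , x≤c ∷ All.map (λ x≤d → A.trans x≤d d≤c) xs≤d

  e≤⋀ᴬ-list : ∀ {c xs} → All (c A.≤_) xs → e c ≤ ⋀ᴬ (λ a → Any (a A.≈_) xs)
  e≤⋀ᴬ-list c≤xs = ⋀ᴬ-greatest λ a∈xs → let c≤x , a≈x = All.lookupAny c≤xs a∈xs in
    e-mono (A.trans c≤x (A.reflexive (A.Eq.sym a≈x)))

  ⋁ᴬ-list≤e : ∀ {c xs} → All (A._≤ c) xs → ⋁ᴬ (λ a → Any (a A.≈_) xs) ≤ e c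
  ⋁ᴬ-list≤e xs≤c = ⋁ᴬ-least λ a∈xs → let x≤c , a≈x = All.lookupAny xs≤c a∈xs in
    e-mono (A.trans (A.reflexive a≈x) x≤c)

  -- A finite part of a filtered set has a lower bound in the set, which replaces the finite meet
  -- supplied by `compact`.
  filtered-compact : ∀ {S c} → Filtered S → ⋀ᴬ S ≤ e c → ∃[ s ] S s × s A.≤ c
  filtered-compact {S} {c} filt ⋀S≤c with
    compact S (c A.≈_) (trans ⋀S≤c (reflexive (proj₂ (e-ideal c))))
  ... | xs , ys , S-xs , ys≈c , ⋀xs≤⋁ys =
    let s , Ss , s≤xs = list-lower-bound filt S-xs
    in s , Ss , e-cancel (trans (e≤⋀ᴬ-list s≤xs) (trans ⋀xs≤⋁ys
         (⋁ᴬ-list≤e (All.map (A.reflexive ∘ A.Eq.sym) ys≈c))))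

  directed-compact : ∀ {T c} → Directed T → e c ≤ ⋁ᴬ T → ∃[ t ] T t × c A.≤ t
  directed-compact {T} {c} dir c≤⋁T with
    compact (c A.≈_) T (trans (reflexive (Eq.sym (proj₂ (e-filter c)))) c≤⋁T)
  ... | xs , ys , xs≈c , T-ys , ⋀xs≤⋁ys =
    let t , Tt , ys≤t = list-upper-bound dir T-ys
    in t , Tt , e-cancel (trans (e≤⋀ᴬ-list (All.map A.reflexive xs≈c))
         (trans ⋀xs≤⋁ys (⋁ᴬ-list≤e ys≤t)))

  -- The elements of `A` above `p` are filtered, so compactness yields a single one below a finite
  -- join of generators of `q`.
  interpolate : ∀ {p q} → IsFilterElement p → IsIdealElement q → p ≤ q →
                ∃[ a ] a ∈[ p , q ]
  interpolate {p} {q} (S , p≈⋀S) (T , q≈⋁T) p≤q with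
    compact S T (trans (reflexive (Eq.sym p≈⋀S)) (trans p≤q (reflexive q≈⋁T)))
  ... | xs , ys , S-xs , T-ys , ⋀xs≤⋁ys =
    let a , p≤a , a≤xs = list-lower-bound above-p
          (All.map (λ Sx → trans (reflexive p≈⋀S) (⋀ᴬ-lower Sx)) S-xs)
    in a , p≤a , trans (e≤⋀ᴬ-list a≤xs) (trans ⋀xs≤⋁ys
         (⋁ᴬ-least λ {b} b∈ys → let Ty , b≈y = All.lookupAny T-ys b∈ys in
           trans (reflexive (e-cong b≈y))
             (trans (⋁ᴬ-upper Ty) (reflexive (Eq.sym q≈⋁T)))))
    where
    above-p : Filtered λ a → p ≤ e a
    above-p = (A.⊤ , ≤e⊤ p) , λ {a} {b} p≤a p≤b →
      a A.∧ b , trans (∧-greatest p≤a p≤b) (reflexive (Eq.sym (e-∧ a b))) ,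
      A.x∧y≤x a b , A.x∧y≤y a b

  F-filtered : ∀ (x : X) → Filtered (F x)
  F-filtered x = (A.⊤ , F-⊤ x) , λ {a} {b} Fa Fb →
    a A.∧ b , F-∧ x Fa Fb , A.x∧y≤x a b , A.x∧y≤y a b

  I-directed : ∀ (x : X) → Directed (I x)
  I-directed x = (A.⊥ , I-⊥ x) , λ {a} {b} Ia Ib →
    a A.∨ b , I-∨ x Ia Ib , A.x≤x∨y a b , A.y≤x∨y a b

  ν≤e⇒F : ∀ x {a} → ν x ≤ e a → F x a
  ν≤e⇒F x ν≤a = let s , Fs , s≤a = filtered-compact (F-filtered x) ν≤a in
    F-upward x s≤a Fs

  e≤μ⇒I : ∀ x {a} → e a ≤ μ x → I x a
  e≤μ⇒I x a≤μ = let t , It , a≤t = directed-compact (I-directed x) a≤μ in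
    I-downward x a≤t It

  -- Join-irreducibles and prime ideals.

  join-dense : ∀ {u w} → ¬ u ≤ w →
               ∃[ j ] IsCompletelyJoinIrreducible j × j ≤ u × ¬ j ≤ w
  join-dense u≰w =
    -- In the opposite lattice, which is algebraic as well, meet-irreducibles are the
    -- join-irreducibles wanted here.
    let j , j≤u , j≰w , irr = separating-meet-irreducible em funext
          (completeLattice ᵒᵖ) (proj₂ isDoublyAlgebraic) u≰w
    in j , irr , j≤u , j≰w

  -- A join-irreducible `j ≤ u` not below `μ z` is a meet of elements of `A`. None of them is in
  -- `I z`, so all are in `F z` and `ν z ≤ j`.
  κ-dichotomy : ∀ z u → ν z ≤ u ⊎ u ≤ μ z
  κ-dichotomy z u with em {P = u ≤ μ z}
  ... | yes u≤μ = inj₂ u≤μ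
  ... | no  u≰μ = inj₁
    (let j , irr , j≤u , j≰μ = join-dense u≰μ
         S , j≈⋀S = dense irr
     in trans (trans
          (⋀ᴬ-greatest {S} λ Sa → ⋀ᴬ-lower λ Ia →
            j≰μ (trans (reflexive j≈⋀S) (trans (⋀ᴬ-lower Sa) (⋁ᴬ-upper Ia))))
          (reflexive (Eq.sym j≈⋀S))) j≤u)

  -- Distributivity writes `j` as the join of `j ∧ a` and `j ∧ b`, so irreducibility makes it one of
  -- them.
  irreducible⇒prime : ∀ {j a b} → IsCompletelyJoinIrreducible j →
                      j ≤ a ∨ b → j ≤ a ⊎ j ≤ b
  irreducible⇒prime {j} {a} {b} irr j≤a∨b with irr S j≈⋁S
    where
    S : Pred Carrier (suc ℓ)
    S s = s ≈ j ∧ a ⊎ s ≈ j ∧ b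
    j≈⋁S : j ≈ ⋁ S
    j≈⋁S = antisym
      (trans (trans (∧-greatest ≤-refl j≤a∨b)
                    (reflexive (IsDistributiveLattice.∧-distribˡ-∨
                      (CanonicalExtension.isDistributiveLattice Aᵟ) j a b)))
        (∨-least (⋁-upper S (inj₁ Eq.refl)) (⋁-upper S (inj₂ Eq.refl))))
      (⋁-least S [ (λ s≈ → trans (reflexive s≈) (x∧y≤x j a))
                 , (λ s≈ → trans (reflexive s≈) (x∧y≤x j b)) ]′)
  ... | s , inj₁ s≈ , j≈s = inj₁ (trans (reflexive (Eq.trans j≈s s≈)) (x∧y≤y j a))
  ... | s , inj₂ s≈ , j≈s = inj₂ (trans (reflexive (Eq.trans j≈s s≈)) (x∧y≤y j b))

  -- The point dual to `j`: its filter is the trace on `A` of the up-set of `j`, resized because the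
  -- order of A^δ lives one universe higher.
  irreducible-prime : ∀ {j b} → IsCompletelyJoinIrreducible j → ¬ j ≤ e b → X
  irreducible-prime {j} {b} irr j≰b = record
    { I          = λ c → Resize em ℓ (¬ j ≤ e c)
    ; I-downward = λ c≤d d∈I → resize em λ j≤c →
                     unresize em d∈I (trans j≤c (e-mono c≤d))
    ; I-⊥        = resize em λ j≤⊥ → j≰b (trans j≤⊥ (e⊥≤ (e b)))
    ; I-∨        = λ {c} {d} c∈I d∈I → resize em λ j≤c∨d →
                     [ unresize em c∈I , unresize em d∈I ]′
                       (irreducible⇒prime irr (trans j≤c∨d (reflexive (e-∨ c d))))
    ; I-proper   = λ ⊤∈I → unresize em ⊤∈I (≤e⊤ j)
    ; I-prime    = prime
    }
    where
    prime : ∀ {c d} → Resize em ℓ (¬ j ≤ e (c A.∧ d)) →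
            Resize em ℓ (¬ j ≤ e c) ⊎ Resize em ℓ (¬ j ≤ e d)
    prime {c} {d} c∧d∈I with em {P = j ≤ e c}
    ... | no  j≰c = inj₁ (resize em j≰c)
    ... | yes j≤c = inj₂ (resize em λ j≤d → unresize em c∧d∈I
      (trans (∧-greatest j≤c j≤d) (reflexive (Eq.sym (e-∧ c d)))))

  -- The prime ideal theorem for `A`, obtained from the irreducibles of A^δ instead of a second
  -- maximality argument.
  prime-separation : ∀ {a b} → ¬ a A.≤ b → ∃[ x ] F x a × I x b
  prime-separation {a} {b} a≰b =
    let j , irr , j≤a , j≰b = join-dense {e a} {e b} λ ea≤eb → a≰b (e-cancel ea≤eb)
    in irreducible-prime irr j≰b , (λ a∈I → unresize em a∈I j≤a) , resize em j≰b

  -- The σ- and π-extensions of `⊖` at points.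

  σ-Terms π-Terms : Carrier → Carrier → Pred Carrier (suc ℓ)
  σ-Terms u v r = ∃[ p₁ ] ∃[ q₁ ] ∃[ p₂ ] ∃[ q₂ ]
    Bracket u p₁ q₁ × Bracket v p₂ q₂ × r ≈ ⋀ (differences p₁ q₁ p₂ q₂)
  π-Terms u v r = ∃[ p₁ ] ∃[ q₁ ] ∃[ p₂ ] ∃[ q₂ ]
    Bracket u p₁ q₁ × Bracket v p₂ q₂ × r ≈ ⋁ (differences p₁ q₁ p₂ q₂)

  -- The given `a` and `b` may miss the bracket; meeting `a` with the interpolant `a₁` and joining
  -- `b` with `b₁` moves them inside and only decreases `a ⊖ b`.
  ⊖σ-μ≤μ : ∀ x y {u} →
    (∀ {p} → IsFilterElement p → p ≤ u → ∃[ a ] ∃[ b ] p ≤ e a × I y b × I x (a ⊖ b)) →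
    u ⊖σ μ y ≤ μ x
  ⊖σ-μ≤μ x y {u} approx = ⋁-least (σ-Terms u (μ y)) λ
    (p₁ , q₁ , p₂ , q₂ , (p₁-filter , q₁-ideal , p₁≤u , u≤q₁)
                       , (p₂-filter , _ , p₂≤μ , μ≤q₂) , r≈) →
    let a , b , p₁≤a , b∈I , a⊖b∈I = approx p₁-filter p₁≤u
        a₁ , p₁≤a₁ , a₁≤q₁ = interpolate p₁-filter q₁-ideal (trans p₁≤u u≤q₁)
        b₁ , p₂≤b₁ , b₁≤μ = interpolate p₂-filter (μ-ideal y) p₂≤μ
        b∨b₁∈I = I-∨ y b∈I (e≤μ⇒I y b₁≤μ)
    in trans (reflexive r≈) (trans
      (⋀-lower (differences p₁ q₁ p₂ q₂) (a A.∧ a₁ , b A.∨ b₁ ,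
        (trans (∧-greatest p₁≤a p₁≤a₁) (reflexive (Eq.sym (e-∧ a a₁)))
          , trans (e-mono (A.x∧y≤y a a₁)) a₁≤q₁) ,
        (trans p₂≤b₁ (e-mono (A.y≤x∨y b b₁))
          , trans (⋁ᴬ-upper b∨b₁∈I) μ≤q₂) ,
        Eq.refl))
      (⋁ᴬ-upper (I-downward x (⊖-mono (A.x∧y≤x a a₁) (A.x≤x∨y b b₁)) a⊖b∈I)))

  ν≤⊖π-ν : ∀ x y {v} →
    (∀ {q} → IsIdealElement q → v ≤ q → ∃[ a ] ∃[ b ] e a ≤ q × F y b × F x (a ⊖ b)) →
    ν x ≤ v ⊖π ν y
  ν≤⊖π-ν x y {v} approx = ⋀-greatest (π-Terms v (ν y)) λ
    (p₁ , q₁ , p₂ , q₂ , (p₁-filter , q₁-ideal , p₁≤v , v≤q₁)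
                       , (_ , q₂-ideal , p₂≤ν , ν≤q₂) , r≈) →
    let a , b , a≤q₁ , b∈F , a⊖b∈F = approx q₁-ideal v≤q₁
        a₁ , p₁≤a₁ , a₁≤q₁ = interpolate p₁-filter q₁-ideal (trans p₁≤v v≤q₁)
        b₁ , ν≤b₁ , b₁≤q₂ = interpolate (ν-filter y) q₂-ideal ν≤q₂
        b∧b₁∈F = F-∧ y b∈F (ν≤e⇒F y ν≤b₁)
    in trans (⋀ᴬ-lower (F-upward x (⊖-mono (A.x≤x∨y a a₁) (A.x∧y≤x b b₁)) a⊖b∈F))
      (trans (⋁-upper (differences p₁ q₁ p₂ q₂) (a A.∨ a₁ , b A.∧ b₁ ,
        (trans p₁≤a₁ (e-mono (A.y≤x∨y a a₁))
          , trans (reflexive (e-∨ a a₁)) (∨-least a≤q₁ a₁≤q₁)) ,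
        (trans p₂≤ν (⋀ᴬ-lower b∧b₁∈F)
          , trans (e-mono (A.x∧y≤y b b₁)) b₁≤q₂) ,
        Eq.refl))
      (reflexive (Eq.sym r≈)))

  -- One bracket suffices, with `ν z` as lower bound of `u` and `μ y` as upper bound of itself: its
  -- differences come from `F z` and `I y`, and these are filtered, so compactness against `μ x`
  -- selects one.
  ν-⊖σ-μ : ∀ x y z {u} → ν z ≤ u → u ⊖σ μ y ≤ μ x →
           ∃[ a ] ∃[ b ] F z a × I y b × I x (a ⊖ b)
  ν-⊖σ-μ x y z {u} ν≤u u⊖μ≤μ =
    let c , S≤c , c≤μ = interpolate (S , Eq.refl) (μ-ideal x) (trans S≤⋀ (trans ⋀≤⊖σ u⊖μ≤μ))
        d , (a , b , Fa , Ib , d≈) , d≤c = filtered-compact S-filtered S≤c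
    in a , b , Fa , Ib ,
       I-downward x (A.trans (A.reflexive (A.Eq.sym d≈)) d≤c) (e≤μ⇒I x c≤μ)
    where
    S : Pred A.Carrier ℓ
    S c = ∃[ a ] ∃[ b ] F z a × I y b × c A.≈ a ⊖ b
    S-filtered : Filtered S
    S-filtered = (_ , A.⊤ , A.⊥ , F-⊤ z , I-⊥ y , A.Eq.refl) ,
      λ (a , b , Fa , Ib , c≈) (a′ , b′ , Fa′ , Ib′ , c′≈) →
        _ , (a A.∧ a′ , b A.∨ b′ , F-∧ z Fa Fa′ , I-∨ y Ib Ib′ , A.Eq.refl) ,
        A.trans (⊖-mono (A.x∧y≤x a a′) (A.x≤x∨y b b′)) (A.reflexive (A.Eq.sym c≈)) ,
        A.trans (⊖-mono (A.x∧y≤y a a′) (A.y≤x∨y b b′)) (A.reflexive (A.Eq.sym c′≈))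
    D : Pred Carrier (suc ℓ)
    D = differences (ν z) (e A.⊤) (e A.⊥) (μ y)
    S≤⋀ : ⋀ᴬ S ≤ ⋀ D
    S≤⋀ = ⋀-greatest D λ (a , b , (ν≤a , _) , (_ , b≤μ) , r≈) →
      trans (⋀ᴬ-lower (a , b , ν≤e⇒F z ν≤a , e≤μ⇒I y b≤μ , A.Eq.refl))
        (reflexive (Eq.sym r≈))
    ⋀≤⊖σ : ⋀ D ≤ u ⊖σ μ y
    ⋀≤⊖σ = ⋁-upper (σ-Terms u (μ y)) (ν z , e A.⊤ , e A.⊥ , μ y ,
      (ν-filter z , e-ideal A.⊤ , ν≤u , ≤e⊤ u) ,
      (e-filter A.⊥ , μ-ideal y , e⊥≤ (μ y) , ≤-refl) , Eq.refl)

  μ-⊖π-ν : ∀ x y z {v} → v ≤ μ z → ν x ≤ v ⊖π ν y →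
           ∃[ a ] ∃[ b ] I z a × F y b × F x (a ⊖ b)
  μ-⊖π-ν x y z {v} v≤μ ν≤v⊖ν =
    let c , ν≤c , c≤S = interpolate (ν-filter x) (S , Eq.refl) (trans ν≤v⊖ν (trans ⊖π≤⋁ ⋁≤S))
        d , (a , b , Ia , Fb , d≈) , c≤d = directed-compact S-directed c≤S
    in a , b , Ia , Fb ,
       F-upward x (A.trans c≤d (A.reflexive d≈)) (ν≤e⇒F x ν≤c)
    where
    S : Pred A.Carrier ℓ
    S c = ∃[ a ] ∃[ b ] I z a × F y b × c A.≈ a ⊖ b
    S-directed : Directed S
    S-directed = (_ , A.⊥ , A.⊤ , I-⊥ z , F-⊤ y , A.Eq.refl) ,
      λ (a , b , Ia , Fb , c≈) (a′ , b′ , Ia′ , Fb′ , c′≈) →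
        _ , (a A.∨ a′ , b A.∧ b′ , I-∨ z Ia Ia′ , F-∧ y Fb Fb′ , A.Eq.refl) ,
        A.trans (A.reflexive c≈) (⊖-mono (A.x≤x∨y a a′) (A.x∧y≤x b b′)) ,
        A.trans (A.reflexive c′≈) (⊖-mono (A.y≤x∨y a a′) (A.x∧y≤y b b′))
    D : Pred Carrier (suc ℓ)
    D = differences (e A.⊥) (μ z) (ν y) (e A.⊤)
    ⋁≤S : ⋁ D ≤ ⋁ᴬ S
    ⋁≤S = ⋁-least D λ (a , b , (_ , a≤μ) , (ν≤b , _) , r≈) →
      trans (reflexive r≈)
        (⋁ᴬ-upper (a , b , e≤μ⇒I z a≤μ , ν≤e⇒F y ν≤b , A.Eq.refl))
    ⊖π≤⋁ : v ⊖π ν y ≤ ⋁ D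
    ⊖π≤⋁ = ⋀-lower (π-Terms v (ν y)) (e A.⊥ , μ z , ν y , e A.⊤ ,
      (e-filter A.⊥ , μ-ideal z , e⊥≤ v , v≤μ) ,
      (ν-filter y , e-ideal A.⊤ , ≤-refl , ≤e⊤ (ν y)) , Eq.refl)

  -- The partial operations described inside `A`.

  sum : ∀ x y → dom+ x y → X
  sum x y y≤ix = record
    { I          = λ a → ∃[ b ] I y b × I x (a ⊖ b)
    ; I-downward = λ a≤a′ (b , b∈I , a′⊖b∈I) →
                     b , b∈I , I-downward x (⊖-monoˡ b a≤a′) a′⊖b∈I
    ; I-⊥        = A.⊥ , I-⊥ y , I-downward x (A.reflexive (A.⊥-⊖ A.⊥)) (I-⊥ x)
    ; I-∨        = λ {a} {a′} (b , b∈I , a⊖b∈I) (b′ , b′∈I , a′⊖b′∈I) →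
                     b A.∨ b′ , I-∨ y b∈I b′∈I ,
                     I-downward x (A.reflexive (A.∨-⊖ a a′ (b A.∨ b′)))
                       (I-∨ x (I-downward x (⊖-antiʳ a (A.x≤x∨y b b′)) a⊖b∈I)
                              (I-downward x (⊖-antiʳ a′ (A.y≤x∨y b b′)) a′⊖b′∈I))
    -- As `⊤ ⊖ b` is `¬ b`, properness is exactly `dom+ x y`.
    ; I-proper   = λ (b , b∈I , ¬b∈I) → y≤ix b∈I ¬b∈I
    ; I-prime    = λ {a} {a′} (b , b∈I , a∧a′⊖b∈I) →
                     [ (λ a⊖b∈I → inj₁ (b , b∈I , a⊖b∈I))
                     , (λ a′⊖b∈I → inj₂ (b , b∈I , a′⊖b∈I)) ]′
                     (I-prime x (I-downward x
                       (A.reflexive (A.Eq.sym (A.∧-⊖ a a′ b))) a∧a′⊖b∈I))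
    }

  +-sum : ∀ x y (d : dom+ x y) → x + y ↦ sum x y d
  +-sum x y d = d , λ u → mk⇔ (to u) from
    where
    to : ∀ u → u ⊖σ μ y ≤ μ x → u ≤ μ (sum x y d)
    -- If `ν` of the sum were below `u`, some element of its filter would satisfy the condition
    -- defining its ideal.
    to u u⊖μ≤μ = [ (λ ν≤u →
      let a , b , a∉I , b∈I , a⊖b∈I = ν-⊖σ-μ x y (sum x y d) {u} ν≤u u⊖μ≤μ
      in ⊥-elim (a∉I (b , b∈I , a⊖b∈I))) , id ]′ (κ-dichotomy (sum x y d) u)
    from : ∀ {u} → u ≤ μ (sum x y d) → u ⊖σ μ y ≤ μ x
    from u≤μ = ⊖σ-μ≤μ x y λ p-filter p≤u →
      let a , p≤a , a≤μ = interpolate p-filter (μ-ideal (sum x y d)) (trans p≤u u≤μ)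
          b , b∈I , a⊖b∈I = e≤μ⇒I (sum x y d) a≤μ
      in a , b , p≤a , b∈I , a⊖b∈I

  -- The ideal is the complement of the filter of all `a` with `a ⊖ b` in `F x` for some `b` in
  -- `F y`; `dom⋆` is what puts `⊤` in that filter.
  star : ∀ x y → dom⋆ x y → X
  star x y ix≰y = record
    { I          = λ a → ∀ b → F y b → I x (a ⊖ b)
    ; I-downward = λ a≤a′ a′∈I b b∈F → I-downward x (⊖-monoˡ b a≤a′) (a′∈I b b∈F)
    ; I-⊥        = λ b _ → I-downward x (A.reflexive (A.⊥-⊖ b)) (I-⊥ x)
    ; I-∨        = λ {a} {a′} a∈I a′∈I b b∈F →
                     I-downward x (A.reflexive (A.∨-⊖ a a′ b))
                       (I-∨ x (a∈I b b∈F) (a′∈I b b∈F))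
    ; I-proper   = λ ⊤∈I → ix≰y λ {b} ¬b∉I → by-contradiction em λ b∈F →
                     ¬b∉I (⊤∈I b b∈F)
    ; I-prime    = prime
    }
    where
    prime : ∀ {a a′} → (∀ b → F y b → I x ((a A.∧ a′) ⊖ b)) →
            (∀ b → F y b → I x (a ⊖ b)) ⊎ (∀ b → F y b → I x (a′ ⊖ b))
    prime {a} {a′} a∧a′∈I with em {P = ∀ b → F y b → I x (a ⊖ b)}
    ... | yes a∈I = inj₁ a∈I
    ... | no  a∉I with ¬∀⇒∃¬ em a∉I
    -- The witnesses `b` and `b′` merge into `b ∧ b′`, since `⊖` is antitone on the right.
    ...   | b , b∈F , a⊖b∈F = inj₂ λ b′ b′∈F → by-contradiction em λ a′⊖b′∈F →
      F-∧ x (F-upward x (⊖-antiʳ a (A.x∧y≤x b b′)) a⊖b∈F)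
            (F-upward x (⊖-antiʳ a′ (A.x∧y≤y b b′)) a′⊖b′∈F)
        (I-downward x (A.reflexive (A.Eq.sym (A.∧-⊖ a a′ (b A.∧ b′))))
          (a∧a′∈I (b A.∧ b′) (F-∧ y b∈F b′∈F)))

  ≰ˣ-witness : ∀ x y → x ≰ˣ y → ∃[ b ] I x b × F y b
  ≰ˣ-witness x y x≰y = ¬∀⇒∃¬ em {P = I x} {Q = I y} λ x≤y → x≰y (x≤y _)

  ⋆-star : ∀ x y (d : dom⋆ x y) → x ⋆ y ↦ star x y d
  ⋆-star x y d = d , ν≤¬ν , λ v → mk⇔ (to v) from
    where
    ν≤¬ν : ν x ≤ (¬ᵟ ν y)
    -- With `e b` as upper bound of `ν y`, every `¬ a` in the term is above `¬ b`, which lies in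
    -- `F x`.
    ν≤¬ν = let b , ¬b∈F , b∈F = ≰ˣ-witness (i x) y d in
      trans
        (⋀-greatest (λ s → ∃[ a ] a ∈[ ν y , e b ] × s ≈ e (A.¬ a))
          λ (a , (_ , a≤b) , s≈) →
            trans (⋀ᴬ-lower (F-upward x (A.¬-antitone (e-cancel a≤b)) ¬b∈F))
                  (reflexive (Eq.sym s≈)))
        (⋁-upper _ (ν y , e b ,
          (ν-filter y , e-ideal b , ≤-refl , ⋀ᴬ-lower b∈F) , Eq.refl))
    to : ∀ v → ν x ≤ v ⊖π ν y → ν (star x y d) ≤ v
    to v ν≤v⊖ν = [ id , (λ v≤μ →
      let a , b , a∈I , b∈F , a⊖b∈F = μ-⊖π-ν x y (star x y d) {v} v≤μ ν≤v⊖ν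
      in ⊥-elim (a⊖b∈F (a∈I b b∈F))) ]′ (κ-dichotomy (star x y d) v)
    from : ∀ {v} → ν (star x y d) ≤ v → ν x ≤ v ⊖π ν y
    from ν≤v = ν≤⊖π-ν x y λ q-ideal v≤q →
      let a , ν≤a , a≤q = interpolate (ν-filter (star x y d)) q-ideal (trans ν≤v v≤q)
          b , b∈F , a⊖b∈F = ¬∀⇒∃¬ em (ν≤e⇒F (star x y d) ν≤a)
      in a , b , a≤q , b∈F , a⊖b∈F

  -- Condition 2 knows the value `z` only through its residuation law, which is therefore tested at
  -- `e a`.
  +-I : ∀ x y z {a b} → x + y ↦ z → I y b → I x (a ⊖ b) → I z a
  +-I x y z {a} (_ , res) b∈I a⊖b∈I =
    e≤μ⇒I z (Equivalence.to (res (e a))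
      (⊖σ-μ≤μ x y λ _ p≤a → a , _ , p≤a , b∈I , a⊖b∈I))

  ⋆-F : ∀ x y z {a b} → x ⋆ y ↦ z → F y b → F x (a ⊖ b) → F z a
  ⋆-F x y z {a} (_ , _ , res) b∈F a⊖b∈F =
    ν≤e⇒F z (Equivalence.to (res (e a))
      (ν≤⊖π-ν x y λ _ a≤q → a , _ , a≤q , b∈F , a⊖b∈F))

  -- Arithmetic of `⊕` under involution, residuation and commutativity.

  module _ (¬-involutive : A.NegationInvolutive)
           (residual     : A.⊕-RightResidual)
           (⊕-comm       : A.⊕-Commutative) where

    open A using (_⊕_)

    MeetIdentity : Set ℓ
    MeetIdentity = ∀ a b → a A.∧ b A.≈ a ⊖ (a ⊖ b)

    DualCondition : Set (suc ℓ)
    DualCondition = ∀ x x′ y → dom⋆ x y →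
      (∃[ w ] (w ≰ˣ y) × (x′ + w ≤ x ⋆ y)) → x′ ≤ˣ x

    ¬-cong : ∀ {a b} → a A.≈ b → A.¬ a A.≈ A.¬ b
    ¬-cong = A.⊖-cong A.Eq.refl

    -- This is commutativity of `⊕` after applying `¬` and cancelling double negations.
    ¬⊖-swap : ∀ a b → (A.¬ a) ⊖ b A.≈ (A.¬ b) ⊖ a
    ¬⊖-swap a b = A.Eq.trans (A.Eq.sym (¬-involutive _))
      (A.Eq.trans (¬-cong (⊕-comm a b)) (¬-involutive _))

    ⊕-distribˡ-∨ : ∀ a b c → a ⊕ (b A.∨ c) A.≈ (a ⊕ b) A.∨ (a ⊕ c)
    ⊕-distribˡ-∨ a b c = A.Eq.trans (¬-cong (A.⊖-∨ (A.¬ a) b c)) (A.⊖-∧ A.⊤ _ _)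

    ⊕-distribˡ-∧ : ∀ a b c → a ⊕ (b A.∧ c) A.≈ (a ⊕ b) A.∧ (a ⊕ c)
    ⊕-distribˡ-∧ a b c = A.Eq.trans (¬-cong (A.⊖-∧ (A.¬ a) b c)) (A.⊖-∨ A.⊤ _ _)

    ⊕-distribʳ-∨ : ∀ c a b → (a A.∨ b) ⊕ c A.≈ (a ⊕ c) A.∨ (b ⊕ c)
    ⊕-distribʳ-∨ c a b = A.Eq.trans (⊕-comm _ c)
      (A.Eq.trans (⊕-distribˡ-∨ c a b) (A.∨-cong (⊕-comm c a) (⊕-comm c b)))

    ⊕-distribʳ-∧ : ∀ c a b → (a A.∧ b) ⊕ c A.≈ (a ⊕ c) A.∧ (b ⊕ c)
    ⊕-distribʳ-∧ c a b = A.Eq.trans (⊕-comm _ c)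
      (A.Eq.trans (⊕-distribˡ-∧ c a b) (A.∧-cong (⊕-comm c a) (⊕-comm c b)))

    ⊕-monoʳ : ∀ a {b c} → b A.≤ c → a ⊕ b A.≤ a ⊕ c
    ⊕-monoʳ a b≤c = A.¬-antitone (⊖-antiʳ (A.¬ a) b≤c)

    ⊕-monoˡ : ∀ c {a b} → a A.≤ b → a ⊕ c A.≤ b ⊕ c
    ⊕-monoˡ c a≤b = A.¬-antitone (⊖-monoˡ c (A.¬-antitone a≤b))

    ⊕-identityʳ : ∀ a → a ⊕ A.⊥ A.≈ a
    ⊕-identityʳ a = A.Eq.trans (¬-cong (A.⊖-⊥ (A.¬ a))) (¬-involutive a)

    ⊕-zeroʳ : ∀ a → a ⊕ A.⊤ A.≈ A.⊤
    ⊕-zeroʳ a = A.Eq.trans (¬-cong (A.⊖-⊤ (A.¬ a))) (A.⊖-⊥ A.⊤)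

    a≤[a⊖b]⊕b : ∀ a b → a A.≤ (a ⊖ b) ⊕ b
    a≤[a⊖b]⊕b a b = Equivalence.from (residual a (a ⊖ b) b) A.refl

    [a⊕b]⊖b≤a : ∀ a b → (a ⊕ b) ⊖ b A.≤ a
    [a⊕b]⊖b≤a a b = Equivalence.to (residual (a ⊕ b) a b) A.refl

    a≤a⊕b : ∀ a b → a A.≤ a ⊕ b
    a≤a⊕b a b = A.trans (A.reflexive (A.Eq.sym (⊕-identityʳ a)))
      (⊕-monoʳ a (A.minimum b))

    ⊤≤¬a⊕a : ∀ a → A.⊤ A.≤ (A.¬ a) ⊕ a
    ⊤≤¬a⊕a a = a≤[a⊖b]⊕b A.⊤ a

    [a⊕b]⊖b : ∀ a b → (a ⊕ b) ⊖ b A.≈ (A.¬ b) ⊖ ((A.¬ b) ⊖ a)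
    [a⊕b]⊖b a b = A.Eq.trans (¬⊖-swap _ b) (A.⊖-cong A.Eq.refl (¬⊖-swap a b))

    -- The half of condition 1 that always holds: commuting the summands in `a ≤ (a ⊖ b) ⊕ b` and
    -- residuating again gives the bound `b`.
    a⊖[a⊖b]≤a∧b : ∀ a b → a ⊖ (a ⊖ b) A.≤ a A.∧ b
    a⊖[a⊖b]≤a∧b a b = A.∧-greatest
      (A.trans (⊖-antiʳ a (A.minimum _)) (A.reflexive (A.⊖-⊥ a)))
      (Equivalence.to (residual a b (a ⊖ b))
        (A.trans (a≤[a⊖b]⊕b a b) (A.reflexive (⊕-comm _ b))))

    -- From condition 1 to condition 2.

    meet-identity⇒dual-condition : MeetIdentity → DualCondition
    meet-identity⇒dual-condition meet x x′ y ix≰y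
      (w , w≰y , s , t , x′+w↦s , x⋆y↦t , s≤t) {a} a∈Ix′ = by-contradiction em λ a∈Fx →
        let b₀ , b₀∈Iw , b₀∈Fy = ≰ˣ-witness w y w≰y
            b₁ , ¬b₁∈Fx , b₁∈Fy = ≰ˣ-witness (i x) y ix≰y
            -- The meet serves both purposes: below `b₀` it is in `I w`, below `b₁` its negation is
            -- in `F x`, and it stays in `F y`.
            b = b₀ A.∧ b₁
            b∈Iw = I-downward w (A.x∧y≤x b₀ b₁) b₀∈Iw
            ¬b∈Fx = F-upward x (A.¬-antitone (A.x∧y≤y b₀ b₁)) ¬b₁∈Fx
            a⊕b⊖b∈Fx = F-upward x
              (A.reflexive (A.Eq.trans (meet (A.¬ b) a) (A.Eq.sym ([a⊕b]⊖b a b))))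
              (F-∧ x ¬b∈Fx a∈Fx)
            a⊕b∈Is = +-I x′ w s x′+w↦s b∈Iw (I-downward x′ ([a⊕b]⊖b≤a a b) a∈Ix′)
        in ⋆-F x y t x⋆y↦t (F-∧ y b₀∈Fy b₁∈Fy) a⊕b⊖b∈Fx (s≤t a⊕b∈Is)

    -- From condition 2 to condition 1: points refuting condition 2.

    module Counterexample (x : X) {a b} (a∈F : F x a) (¬b∈F : F x (A.¬ b))
                          (a⊕b⊖b∈I : I x ((a ⊕ b) ⊖ b)) where

      -- `F y` is the largest filter for which `a ⊕ b` can lie in the ideal of `x ⋆ y`; it contains
      -- `b` because `(a ⊕ b) ⊖ b` is in `I x`.
      y : X
      y = record
        { I          = λ c → F x ((a ⊕ b) ⊖ c)
        ; I-downward = λ c≤d d∈I → F-upward x (⊖-antiʳ _ c≤d) d∈I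
        ; I-⊥        = F-upward x (A.trans (a≤a⊕b a b)
                         (A.reflexive (A.Eq.sym (A.⊖-⊥ _)))) a∈F
        ; I-∨        = λ c∈I d∈I → F-upward x (A.reflexive (A.Eq.sym (A.⊖-∨ _ _ _)))
                         (F-∧ x c∈I d∈I)
        ; I-proper   = λ ⊤∈I → ⊤∈I (I-downward x (A.reflexive (A.⊖-⊤ _)) (I-⊥ x))
        ; I-prime    = prime
        }
        where
        prime : ∀ {c d} → F x ((a ⊕ b) ⊖ (c A.∧ d)) →
                F x ((a ⊕ b) ⊖ c) ⊎ F x ((a ⊕ b) ⊖ d)
        prime {c} {d} c∧d∈I with em {P = I x ((a ⊕ b) ⊖ c)}
        ... | no  c∈I = inj₁ c∈I
        ... | yes c∉I = inj₂ λ d∉I →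
          c∧d∈I (I-downward x (A.reflexive (A.⊖-∧ _ c d)) (I-∨ x c∉I d∉I))

      b∈Fy : F y b
      b∈Fy b∈Iy = b∈Iy a⊕b⊖b∈I

      x⋆y : dom⋆ x y
      x⋆y ix≤y = b∈Fy (ix≤y ¬b∈F)

      t : X
      t = star x y x⋆y

      a⊕b∈It : I t (a ⊕ b)
      a⊕b∈It c c∈Fy = by-contradiction em c∈Fy

      -- The largest ideal keeping every `a ⊕ c` in `I t`; it contains `b`, which `I y` does not,
      -- whence `w ≰ˣ y`.
      w : X
      w = record
        { I          = λ c → I t (a ⊕ c)
        ; I-downward = λ c≤d d∈I → I-downward t (⊕-monoʳ a c≤d) d∈I
        ; I-⊥        = I-downward t (⊕-monoʳ a (A.minimum b)) a⊕b∈It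
        ; I-∨        = λ {c} {d} c∈I d∈I →
                         I-downward t (A.reflexive (⊕-distribˡ-∨ a c d))
                           (I-∨ t {a ⊕ c} {a ⊕ d} c∈I d∈I)
        ; I-proper   = λ ⊤∈I → I-proper t
                         (I-downward t (A.reflexive (A.Eq.sym (⊕-zeroʳ a))) ⊤∈I)
        ; I-prime    = λ {c} {d} c∧d∈I → I-prime t {a ⊕ c} {a ⊕ d}
                         (I-downward t (A.reflexive (A.Eq.sym (⊕-distribˡ-∧ a c d))) c∧d∈I)
        }

      -- By residuation, the largest ideal for which the sum with `w` lies below `t`; it contains
      -- `a` by the choice of `w`.
      x′ : X
      x′ = record
        { I          = λ c → ∀ d → I w d → I t (c ⊕ d)
        ; I-downward = λ c≤c′ c′∈I d d∈I → I-downward t (⊕-monoˡ d c≤c′) (c′∈I d d∈I)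
        ; I-⊥        = λ d d∈I → I-downward t (⊕-monoˡ d (A.minimum a)) d∈I
        ; I-∨        = λ {c} {c′} c∈I c′∈I d d∈I →
                         I-downward t (A.reflexive (⊕-distribʳ-∨ d c c′))
                           (I-∨ t {c ⊕ d} {c′ ⊕ d} (c∈I d d∈I) (c′∈I d d∈I))
        ; I-proper   = λ ⊤∈I → I-proper t
                         (I-downward t (a≤a⊕b A.⊤ A.⊥) (⊤∈I A.⊥ (I-⊥ w)))
        ; I-prime    = prime
        }
        where
        prime : ∀ {c c′} → (∀ d → I w d → I t ((c A.∧ c′) ⊕ d)) →
                (∀ d → I w d → I t (c ⊕ d)) ⊎ (∀ d → I w d → I t (c′ ⊕ d))
        prime {c} {c′} c∧c′∈I with em {P = ∀ d → I w d → I t (c ⊕ d)}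
        ... | yes c∈I = inj₁ c∈I
        ... | no  c∉I with ¬∀⇒∃¬ em c∉I
        ...   | d , d∈I , c⊕d∉I = inj₂ λ d′ d′∈I → by-contradiction em λ c′⊕d′∉I →
          F-∧ t {c ⊕ (d A.∨ d′)} {c′ ⊕ (d A.∨ d′)}
            (F-upward t (⊕-monoʳ c (A.x≤x∨y d d′)) c⊕d∉I)
            (F-upward t (⊕-monoʳ c′ (A.y≤x∨y d d′)) c′⊕d′∉I)
            (I-downward t (A.reflexive (A.Eq.sym (⊕-distribʳ-∧ (d A.∨ d′) c c′)))
              (c∧c′∈I (d A.∨ d′) (I-∨ w {d} {d′} d∈I d′∈I)))

      x′+w : dom+ x′ w
      -- Otherwise `(¬ c) ⊕ c`, which is the top element, would be in `I t`.
      x′+w {c} c∈Iw ¬c∈Ix′ = I-proper t (I-downward t (⊤≤¬a⊕a c) (¬c∈Ix′ c c∈Iw))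

      x′+w≤x⋆y : x′ + w ≤ x ⋆ y
      x′+w≤x⋆y = sum x′ w x′+w , t , +-sum x′ w x′+w , ⋆-star x y x⋆y ,
        λ {c} (d , d∈Iw , c⊖d∈Ix′) →
          I-downward t (a≤[a⊖b]⊕b c d) (c⊖d∈Ix′ d d∈Iw)

      dual-condition-fails : ¬ DualCondition
      dual-condition-fails cond =
        a∈F (cond x x′ y x⋆y (w , (λ w≤y → b∈Fy (w≤y a⊕b∈It)) , x′+w≤x⋆y)
               {a} (λ _ d∈Iw → d∈Iw))

    dual-condition⇒meet-identity : DualCondition → MeetIdentity
    dual-condition⇒meet-identity cond a b = A.antisym
      (by-contradiction em λ a∧b≰ →
        let x , a∧b∈F , a⊖[a⊖b]∈I = prime-separation a∧b≰
            a≈¬¬a = A.Eq.sym (¬-involutive a)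
        -- With `b` and `¬ a` as parameters, `(b ⊕ ¬ a) ⊖ ¬ a` becomes `a ⊖ (a ⊖ b)` once double
        -- negations cancel.
        in Counterexample.dual-condition-fails x {b} {A.¬ a}
             (F-upward x (A.x∧y≤y a b) a∧b∈F)
             (F-upward x (A.trans (A.x∧y≤x a b) (A.reflexive a≈¬¬a)) a∧b∈F)
             (I-downward x (A.reflexive (A.Eq.trans ([a⊕b]⊖b b (A.¬ a))
               (A.⊖-cong (¬-involutive a) (A.⊖-cong (¬-involutive a) A.Eq.refl))))
               a⊖[a⊖b]∈I)
             cond)
      (a⊖[a⊖b]≤a∧b a b)

proposition4p3 :
    (em : ∀ {p} → ExcludedMiddle p) (funext : ∀ {a b} → Extensionality a b) →
    ∀ {ℓ} (A : ⊖-Algebra ℓ) (Aᵟ : CanonicalExtension A) →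
    let open ⊖-Algebra A
        open ExtendedDual em A Aᵟ
    in
    NegationInvolutive → ⊕-RightResidual → ⊕-Commutative →
    (∀ a b → a ∧ b ≈ a ⊖ (a ⊖ b))
      ⇔
    (∀ (x x′ y : X) → dom⋆ x y →
      (∃[ w ] (w ≰ˣ y) × (x′ + w ≤ x ⋆ y)) →
      x′ ≤ˣ x)
proposition4p3 em funext A Aᵟ ¬-involutive residual ⊕-comm = mk⇔
  (meet-identity⇒dual-condition em funext A Aᵟ ¬-involutive residual ⊕-comm)
  (dual-condition⇒meet-identity em funext A Aᵟ ¬-involutive residual ⊕-comm)
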